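{- Fix an integer $c\ge2$ and a finite list of integers $L_1,\dots,L_r$ with $L_i\ge2$ for all $i$. Then for all sufficiently large integers $t$ (i.e. there is $t_0$, depending on $c,L_1,\dots,L_r$, such that for every $t\ge t_0$), the spider tree $$S(c,L_1,\dots,L_r,1^t)$$ has a graceful labeling in which the hub has label $1$.
   Context: A graceful labeling of a tree with $n$ vertices is a bijection $f$ from its vertices to $\{0,1,\dots,n-1\}$ such that the set of values $|f(u)-f(v)|$ over edges $uv$ equals $\{1,2,\dots,n-1\}$. The spider tree $S(\ell_1,\dots,\ell_k)$ is obtained from a central hub vertex by attaching $k$ paths (arms) at the hub, where $\ell_i$ is the number of edges of the $i$-th arm; it has $1+\sum_i\ell_i$ vertices. The notation $1^t$ means that there are $t$ further arms of length $1$ (leaves adjacent to the hub). -}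

module Defs where

open import Data.Fin using (Fin; toℕ)
open import Data.List using (List; length; lookup)
open import Data.Nat using (ℕ; suc; _≤_; _<_; ∣_-_∣)
open import Data.Product using (_×_; ∃-syntax)
open import Function.Bundles using (_⤖_; _⇔_; Bijection)
open import Level using (0ℓ)
open import Relation.Binary.Core using (Rel)
open import Relation.Binary.Construct.Closure.Symmetric using (SymClosure)
open import Relation.Binary.PropositionalEquality using (_≡_)

-- `arm i j` is the vertex of the i-th arm at distance 1 + toℕ j from the hub,
-- so that an arm with ℓ edges contributes ℓ vertices besides the hub.
data Vertex (ℓs : List ℕ) : Set where
  hub : Vertex ℓs
  arm : (i : Fin (length ℓs)) → Fin (lookup ℓs i) → Vertex ℓs

-- Edges oriented away from the hub.
data Edge (ℓs : List ℕ) : Rel (Vertex ℓs) 0ℓ where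
  first : ∀ i (j : Fin (lookup ℓs i)) →
          toℕ j ≡ 0 → Edge ℓs hub (arm i j)
  next  : ∀ i (j k : Fin (lookup ℓs i)) →
          toℕ k ≡ suc (toℕ j) → Edge ℓs (arm i j) (arm i k)

Spider : (ℓs : List ℕ) → Rel (Vertex ℓs) 0ℓ
Spider ℓs = SymClosure (Edge ℓs)

-- Gracefulness of a labeling of a tree, given by its adjacency relation on V.
-- The labels are 0, …, n - 1, and the bijection forces n to be the number of
-- vertices.  (For graphs that are not trees the usual notion is different.)
IsGraceful : {V : Set} (_~_ : Rel V 0ℓ) {n : ℕ} → V ⤖ Fin n → Set
IsGraceful _~_ {n} f =
  ∀ d → (∃[ u ] ∃[ v ] (u ~ v × ∣ label u - label v ∣ ≡ d)) ⇔ (1 ≤ d × d < n)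
  where
  label = λ v → toℕ (Bijection.to f v)

{-# OPTIONS --safe #-}
module Submission where

-- Let m be the number of edges.  A neighbour of the hub labeled 1 + d (d ≥ 1)
-- realises the difference d.  So it suffices that all labels 0, …, m are used,
-- that every arm vertex labeled 1 + d not adjacent to the hub comes with an
-- edge of difference d in its arm, and that m is realised by the edge {0, m}.
-- For an arm of length ℓ, the labels 1 + 2^(ℓ-1) a, …, 1 + 2 a, 1 + a do this;
-- increasing scales a keep the arms disjoint.  The arm of length c carries
-- {0, m}: it is m - 1, 0, m if c = 3, and otherwise m, 0 followed by a
-- zigzag through 2, …, c - 1.  All labels used so far except m - 1 and m are
-- bounded independently of t, so for large t they are distinct, and the unused
-- labels go to the leaves.

open import Defs
open import Data.Fin using (Fin; toℕ)
open import Data.List using (List; _∷_; _++_; replicate; sum)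
open import Data.List.Relation.Unary.All using (All)
open import Data.Nat using (ℕ; suc; _≤_; _≥_)
open import Data.Product using (_×_; ∃-syntax; Σ-syntax)
open import Function.Bundles using (_⤖_; Bijection)
open import Relation.Binary.PropositionalEquality using (_≡_)

open import Data.Empty using (⊥-elim)
open import Data.Fin using (zero; suc; fromℕ<)
open import Data.Fin.Properties using (toℕ-fromℕ<; toℕ<n; toℕ-injective)
open import Data.List using ([]; [_]; map; concat; length; lookup; upTo)
open import Data.List.Membership.Propositional using (_∈_; _∉_; find; lose)
open import Data.List.Membership.Propositional.Properties
  using (∈-concat⁻; ∈-∃++; ∈-lookup; ∈-++⁺ˡ; ∈-++⁺ʳ; ∈-upTo⁺; ∈-upTo⁻)
open import Data.List.Properties
  using (++-assoc; concat-++; concat-map-[_]; length-++; length-map; length-upTo; map-++)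
open import Data.List.Relation.Binary.Permutation.Propositional
  using (_↭_; prep; ↭-refl; ↭-sym; ↭-trans; ↭⇒↭ₛ)
open import Data.List.Relation.Binary.Permutation.Propositional.Properties
  using (∈-resp-↭; ↭-length; shift)
import Data.List.Relation.Binary.Permutation.Setoid.Properties as Permₛ
open import Data.List.Relation.Unary.All as All using ([]; _∷_)
import Data.List.Relation.Unary.All.Properties as Allₚ
open import Data.List.Relation.Unary.AllPairs using ([]; _∷_)
open import Data.List.Relation.Unary.Any using (Any; here; there; index)
import Data.List.Relation.Unary.Any.Properties as Anyₚ
open import Data.List.Relation.Unary.Unique.Propositional using (Unique)
import Data.List.Relation.Unary.Unique.Propositional.Properties as Uniq
open import Data.Nat
  using (zero; _+_; _*_; _^_; _<_; ∣_-_∣; z≤n; s≤s; _≤?_; _≟_)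
open import Data.List.Relation.Unary.Unique.DecPropositional _≟_ using (unique?)
open import Data.Nat.ListAction.Properties using (sum-++)
open import Data.Nat.Properties hiding (_≤?_; _≟_)
open import Data.Product using (_,_; proj₁; proj₂; ∃₂)
open import Data.Sum using (_⊎_; inj₁; inj₂)
open import Function using (_∘_; mk⤖; mk⇔)
open import Function.Consequences.Propositional using (strictlySurjective⇒surjective)
open import Relation.Binary.Construct.Closure.Symmetric using (fwd; bwd)
open import Relation.Binary.PropositionalEquality
  using (_≢_; refl; sym; trans; cong; cong₂; subst; setoid; module ≡-Reasoning)
open import Relation.Nullary.Decidable using (Dec; _×-dec_; toWitness)

-- Lists without repetitions

-- The entries of `xs` are taken out of `zs` one at a time. Later, what remains of 0, ..., m in this
-- way becomes the labels of the leaves.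
complement : ∀ {A : Set} {xs zs : List A} → Unique xs → All (_∈ zs) xs → ∃[ ys ] xs ++ ys ↭ zs
complement {xs = []} {zs} _ _ = zs , ↭-refl
complement {A} {xs = x ∷ xs} (x∉xs ∷ u) (x∈zs ∷ xs⊆zs) with ∈-∃++ x∈zs
... | as , bs , refl =
  let ys , p = complement u (All.zipWith (λ (x≢y , y∈zs) → tail x≢y (∈-resp-↭ (shift x as bs) y∈zs)) (x∉xs , xs⊆zs))
  in  ys , ↭-trans (prep x p) (↭-sym (shift x as bs))
  where
  tail : ∀ {y : A} {ws} → x ≢ y → y ∈ x ∷ ws → y ∈ ws
  tail x≢y (here y≡x) = ⊥-elim (x≢y (sym y≡x))
  tail x≢y (there y∈) = y∈

Unique-++⁻ʳ : ∀ {A : Set} (xs : List A) {ys} → Unique (xs ++ ys) → Unique ys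
Unique-++⁻ʳ []       u       = u
Unique-++⁻ʳ (_ ∷ xs) (_ ∷ u) = Unique-++⁻ʳ xs u

Unique-++⁻-disjoint : ∀ {A : Set} {xs ys : List A} {x} → Unique (xs ++ ys) → x ∈ xs → x ∉ ys
Unique-++⁻-disjoint {xs = _ ∷ xs} (x∉ ∷ _) (here refl) x∈ys = All.lookup x∉ (∈-++⁺ʳ xs x∈ys) refl
Unique-++⁻-disjoint (_ ∷ u) (there x∈xs) x∈ys = Unique-++⁻-disjoint u x∈xs x∈ys

-- Uniqueness is assumed of `xs ++ ys` because the lists in question are blocks of a `concat`.
lookup-injective : ∀ {A : Set} (xs : List A) {ys} → Unique (xs ++ ys) →
  ∀ {i j} → lookup xs i ≡ lookup xs j → i ≡ j
lookup-injective (_ ∷ _)  _        {zero}  {zero}  _ = refl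
lookup-injective (_ ∷ xs) (x∉ ∷ _) {zero}  {suc j} e = ⊥-elim (All.lookup x∉ (∈-++⁺ˡ (∈-lookup {xs = xs} j)) e)
lookup-injective (_ ∷ xs) (x∉ ∷ _) {suc i} {zero}  e = ⊥-elim (All.lookup x∉ (∈-++⁺ˡ (∈-lookup {xs = xs} i)) (sym e))
lookup-injective (_ ∷ xs) (_ ∷ u)  {suc i} {suc j} e = cong suc (lookup-injective xs u e)

-- Differences of consecutive labels

-- For an arm `xs` this is applied to `h ∷ xs` with `h` the hub label, so that the edge from the hub
-- to the arm counts as a step as well.
data HasStep (d : ℕ) : List ℕ → Set where
  here  : ∀ {x y xs} → ∣ x - y ∣ ≡ d → HasStep d (x ∷ y ∷ xs)
  there : ∀ {x xs} → HasStep d xs → HasStep d (x ∷ xs)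

HasStep-map-suc : ∀ {d xs} → HasStep d xs → HasStep d (map suc xs)
HasStep-map-suc (here e)  = here e
HasStep-map-suc (there s) = there (HasStep-map-suc s)

HasStep⇒lookup : ∀ {d xs} → HasStep d xs →
  ∃₂ λ j k → toℕ k ≡ suc (toℕ j) × ∣ lookup xs j - lookup xs k ∣ ≡ d
HasStep⇒lookup (here e) = zero , suc zero , refl , e
HasStep⇒lookup (there s) =
  let j , k , p , e = HasStep⇒lookup s in suc j , suc k , cong suc p , e

-- Labelings of spiders given by the lists of labels along the arms

armLabel : ∀ (xss : List (List ℕ)) (i : Fin (length (map length xss))) → Fin (lookup (map length xss) i) → ℕ
armLabel (xs ∷ _)   zero    j = lookup xs j
armLabel (_  ∷ xss) (suc i) j = armLabel xss i j

label : ℕ → ∀ xss → Vertex (map length xss) → ℕ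
label h xss hub       = h
label h xss (arm i j) = armLabel xss i j

skipArm : ∀ {ℓ ℓs} → Vertex ℓs → Vertex (ℓ ∷ ℓs)
skipArm hub       = hub
skipArm (arm i j) = arm (suc i) j

skipArm-Edge : ∀ {ℓ ℓs u v} → Edge ℓs u v → Edge (ℓ ∷ ℓs) (skipArm u) (skipArm v)
skipArm-Edge (first i j p)  = first (suc i) j p
skipArm-Edge (next i j k p) = next (suc i) j k p

label-skipArm : ∀ h xs xss u → label h (xs ∷ xss) (skipArm u) ≡ label h xss u
label-skipArm h xs xss hub       = refl
label-skipArm h xs xss (arm i j) = refl

armLabel-∈ : ∀ xss i j → armLabel xss i j ∈ concat xss
armLabel-∈ (xs ∷ xss) zero    j = ∈-++⁺ˡ (∈-lookup {xs = xs} j)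
armLabel-∈ (xs ∷ xss) (suc i) j = ∈-++⁺ʳ xs (armLabel-∈ xss i j)

armLabel-surjective : ∀ {xss x} → Any (x ∈_) xss → ∃₂ λ i j → armLabel xss i j ≡ x
armLabel-surjective (here x∈xs) = zero , index x∈xs , sym (Anyₚ.lookup-index x∈xs)
armLabel-surjective (there x∈)  =
  let i , j , e = armLabel-surjective x∈ in suc i , j , e

armLabel-injective : ∀ xss → Unique (concat xss) → ∀ {i j i′ j′} →
  armLabel xss i j ≡ armLabel xss i′ j′ → arm {map length xss} i j ≡ arm i′ j′
armLabel-injective (xs ∷ xss) u {zero} {j} {zero} {j′} e = cong (arm zero) (lookup-injective xs u e)
armLabel-injective (xs ∷ xss) u {zero} {j} {suc i′} {j′} e =
  ⊥-elim (Unique-++⁻-disjoint u (∈-lookup {xs = xs} j) (subst (_∈ concat xss) (sym e) (armLabel-∈ xss i′ j′)))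
armLabel-injective (xs ∷ xss) u {suc i} {j} {zero} {j′} e =
  ⊥-elim (Unique-++⁻-disjoint u (∈-lookup {xs = xs} j′) (subst (_∈ concat xss) e (armLabel-∈ xss i j)))
armLabel-injective (xs ∷ xss) u {suc i} {j} {suc i′} {j′} e =
  cong skipArm (armLabel-injective xss (Unique-++⁻ʳ xs u) e)

HasStep⇒Edge : ∀ {h d xss} → Any (λ xs → HasStep d (h ∷ xs)) xss →
  ∃₂ λ u v → Edge (map length xss) u v × ∣ label h xss u - label h xss v ∣ ≡ d
HasStep⇒Edge {xss = (_ ∷ _) ∷ _} (here (here e)) = hub , arm zero zero , first zero zero refl , e
HasStep⇒Edge (here (there s)) =
  let j , k , p , e = HasStep⇒lookup s
  in  arm zero j , arm zero k , next zero j k p , e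
HasStep⇒Edge {h} {xss = xs ∷ xss} (there s) =
  let u , v , u-v , e = HasStep⇒Edge s
  in  skipArm u , skipArm v , skipArm-Edge u-v ,
      trans (cong₂ ∣_-_∣ (label-skipArm h xs xss u) (label-skipArm h xs xss v)) e

Edge-irrefl : ∀ {ℓs u v} → Edge ℓs u v → u ≢ v
Edge-irrefl (next i j .j p) refl = 1+n≢n (sym p)

-- From lists of labels to graceful labelings

GracefulWithHubAt : ℕ → List ℕ → Set
GracefulWithHubAt h ℓs = Σ[ f ∈ (Vertex ℓs ⤖ Fin (suc (sum ℓs))) ]
  (IsGraceful (Spider ℓs) f × toℕ (Bijection.to f hub) ≡ h)

module _ {h : ℕ} {xss : List (List ℕ)}
         (perm : h ∷ concat xss ↭ upTo (suc (sum (map length xss))))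
         (steps : ∀ {d} → 1 ≤ d → d < suc (sum (map length xss)) →
                  Any (λ xs → HasStep d (h ∷ xs)) xss) where

  private
    n : ℕ
    n = suc (sum (map length xss))

    V : Set
    V = Vertex (map length xss)

    unique : Unique (h ∷ concat xss)
    unique = Permₛ.Unique-resp-↭ (setoid ℕ) (↭⇒↭ₛ (↭-sym perm)) (Uniq.upTo⁺ n)

    h∉ : h ∉ concat xss
    h∉ = Uniq.Unique[x∷xs]⇒x∉xs unique

    label-∈ : ∀ v → label h xss v ∈ h ∷ concat xss
    label-∈ hub       = here refl
    label-∈ (arm i j) = there (armLabel-∈ xss i j)

    label-< : ∀ v → label h xss v < n
    label-< v = ∈-upTo⁻ (∈-resp-↭ perm (label-∈ v))

    label-injective : ∀ u v → label h xss u ≡ label h xss v → u ≡ v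
    label-injective hub       hub       _ = refl
    label-injective hub       (arm i j) e = ⊥-elim (h∉ (subst (_∈ concat xss) (sym e) (armLabel-∈ xss i j)))
    label-injective (arm i j) hub       e = ⊥-elim (h∉ (subst (_∈ concat xss) e (armLabel-∈ xss i j)))
    label-injective (arm _ _) (arm _ _) e with _ ∷ u ← unique = armLabel-injective xss u e

    label-surjective : ∀ {x} → x < n → ∃[ v ] label h xss v ≡ x
    label-surjective x<n with ∈-resp-↭ (↭-sym perm) (∈-upTo⁺ x<n)
    ... | here refl = hub , refl
    ... | there x∈  = let i , j , e = armLabel-surjective (∈-concat⁻ xss x∈) in arm i j , e

    to : V → Fin n
    to v = fromℕ< (label-< v)

    toℕ-to : ∀ v → toℕ (to v) ≡ label h xss v
    toℕ-to v = toℕ-fromℕ< (label-< v)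

    to-injective : ∀ {u v} → to u ≡ to v → u ≡ v
    to-injective {u} {v} e = label-injective u v
      (trans (sym (toℕ-to u)) (trans (cong toℕ e) (toℕ-to v)))

    f : V ⤖ Fin n
    f = mk⤖ (to-injective , strictlySurjective⇒surjective λ y →
      let v , e = label-surjective (toℕ<n y) in v , toℕ-injective (trans (toℕ-to v) e))

    -- This half of gracefulness does not rely on `steps`: the difference is positive by
    -- injectivity, and below `n` because both labels are.
    edge-difference : ∀ {u v} → u ≢ v →
      1 ≤ ∣ toℕ (to u) - toℕ (to v) ∣ × ∣ toℕ (to u) - toℕ (to v) ∣ < n
    edge-difference {u} {v} u≢v =
      n≢0⇒n>0 (λ e → u≢v (to-injective (toℕ-injective (∣m-n∣≡0⇒m≡n e)))) ,
      ≤-<-trans (∣m-n∣≤m⊔n (toℕ (to u)) (toℕ (to v))) (⊔-pres-<m (toℕ<n (to u)) (toℕ<n (to v)))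

    graceful : IsGraceful (Spider (map length xss)) f
    graceful d = mk⇔ difference edge
      where
      realised : Set
      realised = ∃₂ λ u v → Spider (map length xss) u v × ∣ toℕ (to u) - toℕ (to v) ∣ ≡ d
      difference : realised → 1 ≤ d × d < n
      difference (u , v , fwd u-v , refl) = edge-difference (Edge-irrefl u-v)
      difference (u , v , bwd v-u , refl) = edge-difference (Edge-irrefl v-u ∘ sym)
      edge : 1 ≤ d × d < n → realised
      edge (1≤d , d<n) =
        let u , v , u-v , e = HasStep⇒Edge (steps 1≤d d<n)
        in  u , v , fwd u-v , trans (cong₂ ∣_-_∣ (toℕ-to u) (toℕ-to v)) e

  gracefulSpider : GracefulWithHubAt h (map length xss)
  gracefulSpider = f , graceful , toℕ-to hub

-- Arms that realise the differences of their own labels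

-- With hub label 1, the edge at the hub already realises the difference d
-- when suc d is the first label of the arm.
SelfStepping : List ℕ → Set
SelfStepping xs = ∀ d → 1 ≤ d → suc d ∈ xs → HasStep d (1 ∷ xs)

SelfStepping-[_] : ∀ x → SelfStepping [ x ]
SelfStepping-[ x ] _ _ (here refl) = here refl

Between : ℕ → ℕ → List ℕ → Set
Between lo hi = All (λ x → lo ≤ x × x ≤ hi)

Between-weaken : ∀ {lo lo′ hi hi′ xs} → lo′ ≤ lo → hi ≤ hi′ → Between lo hi xs → Between lo′ hi′ xs
Between-weaken p q = All.map λ (a , b) → ≤-trans p a , ≤-trans b q

Between-map-suc : ∀ {lo hi xs} → Between lo hi xs → Between (suc lo) (suc hi) (map suc xs)
Between-map-suc = Allₚ.map⁺ ∘ All.map λ (a , b) → s≤s a , s≤s b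

above-∉ : ∀ {lo hi y xs} → hi < y → Between lo hi xs → All (y ≢_) xs
above-∉ hi<y = All.map λ (_ , x≤hi) y≡x → <⇒≱ hi<y (subst (_≤ _) (sym y≡x) x≤hi)

below-∉ : ∀ {lo hi y xs} → y < lo → Between lo hi xs → All (y ≢_) xs
below-∉ y<lo = All.map λ (lo≤x , _) y≡x → <⇒≱ y<lo (subst (_ ≤_) (sym y≡x) lo≤x)

-- Arms of doubling labels

doubling : ℕ → ℕ → List ℕ
doubling a zero    = []
doubling a (suc ℓ) = suc (2 ^ ℓ * a) ∷ doubling a ℓ

length-doubling : ∀ a ℓ → length (doubling a ℓ) ≡ ℓ
length-doubling a zero    = refl
length-doubling a (suc ℓ) = cong suc (length-doubling a ℓ)

2^suc : ∀ ℓ a → 2 ^ suc ℓ * a ≡ 2 ^ ℓ * a + 2 ^ ℓ * a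
2^suc ℓ a = trans (*-assoc 2 (2 ^ ℓ) a) (cong (2 ^ ℓ * a +_) (+-identityʳ _))

-- Each label `suc p` comes right after `suc (p + p)`, at difference `p`. The prepended entry gives
-- the first label such a predecessor too, which makes the induction go through.
doubling-steps : ∀ {d} a ℓ → suc d ∈ doubling a ℓ → HasStep d (suc (2 ^ ℓ * a) ∷ doubling a ℓ)
doubling-steps a (suc ℓ) (here refl) =
  here (trans (cong (∣_- 2 ^ ℓ * a ∣) (2^suc ℓ a)) (∣m+n-m∣≡n (2 ^ ℓ * a) (2 ^ ℓ * a)))
  where
  ∣m+n-m∣≡n : ∀ m n → ∣ m + n - m ∣ ≡ n
  ∣m+n-m∣≡n m n = trans (∣-∣-comm (m + n) m) (∣m-m+n∣≡n m n)
doubling-steps a (suc ℓ) (there d∈) = there (doubling-steps a ℓ d∈)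

doubling-SelfStepping : ∀ a ℓ → SelfStepping (doubling a ℓ)
doubling-SelfStepping a (suc ℓ) _ _ (here refl) = here refl
doubling-SelfStepping a (suc ℓ) _ _ (there d∈)  = there (doubling-steps a ℓ d∈)

-- The upper bound is chosen as the scale of the next arm, whose labels all lie strictly above it.
-- The first label is one more than half this bound, and `1 ≤ a` lets the doubling absorb that one.
doubling-Between : ∀ a ℓ → 1 ≤ a → Between (suc a) (2 ^ ℓ * a) (doubling a ℓ)
doubling-Between a zero    _   = []
doubling-Between a (suc ℓ) 1≤a =
  (s≤s a≤p , suc-p≤) ∷ Between-weaken ≤-refl (≤-trans (n≤1+n _) suc-p≤) (doubling-Between a ℓ 1≤a)
  where
  a≤p : a ≤ 2 ^ ℓ * a
  a≤p = m≤n*m a (2 ^ ℓ) {{m^n≢0 2 ℓ}}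
  suc-p≤ : suc (2 ^ ℓ * a) ≤ 2 ^ suc ℓ * a
  suc-p≤ = subst (suc (2 ^ ℓ * a) ≤_) (sym (2^suc ℓ a)) (+-monoˡ-≤ (2 ^ ℓ * a) (≤-trans 1≤a a≤p))

doubling-Unique : ∀ a ℓ → 1 ≤ a → Unique (doubling a ℓ)
doubling-Unique a zero    _   = []
doubling-Unique a (suc ℓ) 1≤a = above-∉ ≤-refl (doubling-Between a ℓ 1≤a) ∷ doubling-Unique a ℓ 1≤a

-- All labels exceed `lo`, which leaves the values up to `lo` to the central arm. `lo≤hi` is a field
-- of its own because `between` says nothing about `hi` when there are no arms.
record SmallArms (lo : ℕ) (ℓs : List ℕ) : Set where
  field
    {hi}    : ℕ
    {arms}  : List (List ℕ)
    lengths : map length arms ≡ ℓs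
    self    : All SelfStepping arms
    unique  : Unique (concat arms)
    between : Between (suc lo) hi (concat arms)
    lo≤hi   : lo ≤ hi

smallArms : ∀ {lo} → 1 ≤ lo → ∀ ℓs → SmallArms lo ℓs
smallArms 1≤lo [] = record { lengths = refl ; self = [] ; unique = [] ; between = [] ; lo≤hi = ≤-refl }
smallArms {lo} 1≤lo (ℓ ∷ ℓs) = record
  { arms    = doubling lo ℓ ∷ arms
  ; lengths = cong₂ _∷_ (length-doubling lo ℓ) lengths
  ; self    = doubling-SelfStepping lo ℓ ∷ self
  ; unique  = Uniq.++⁺ (doubling-Unique lo ℓ 1≤lo) unique λ (v∈xs , v∈ys) →
      <⇒≱ (proj₁ (All.lookup between v∈ys)) (proj₂ (All.lookup (doubling-Between lo ℓ 1≤lo) v∈xs))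
  ; between = Allₚ.++⁺ (Between-weaken ≤-refl lo≤hi (doubling-Between lo ℓ 1≤lo))
                       (Between-weaken (s≤s lo≤) ≤-refl between)
  ; lo≤hi   = ≤-trans lo≤ lo≤hi
  }
  where
  lo≤ : lo ≤ 2 ^ ℓ * lo
  lo≤ = m≤n*m lo (2 ^ ℓ) {{m^n≢0 2 ℓ}}
  open SmallArms (smallArms (≤-trans 1≤lo lo≤) ℓs)

-- Zigzag paths

-- The reflection x ↦ 2 + k - x exchanges the paths 0 ∷ α and 2 + k ∷ β.  Both
-- are carried along because the recursion k ↦ 3 + k swaps them.  For k = 1
-- there is no such path, which is why arms of length 3 are treated apart.
record Zigzags (k : ℕ) : Set where
  field
    α β : List ℕ
    length-α  : length α ≡ k
    length-β  : length β ≡ k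
    between-α : Between 2 (suc k) α
    between-β : Between 1 k β
    unique-α  : Unique α
    unique-β  : Unique β
    steps-α   : ∀ d → 1 ≤ d → d ≤ k → HasStep d (0 ∷ α)
    steps-β   : ∀ d → 1 ≤ d → d ≤ k → HasStep d (2 + k ∷ β)

-- In both new paths the first three differences are 3 + k, 1 + k and 2 + k. The rest is an old path
-- translated: `4 + k ∷ β⁺` is `2 + k ∷ β` moved up by 2, and `1 ∷ α⁺` is `0 ∷ α` moved up by 1. It
-- provides the differences up to `k`.
zigzags-3+ : ∀ {k} → Zigzags k → Zigzags (3 + k)
zigzags-3+ {k} z = record
  { α = 3 + k ∷ 2 ∷ 4 + k ∷ β⁺
  ; β = 2 ∷ 3 + k ∷ 1 ∷ α⁺
  ; length-α = cong (3 +_) (trans (length-map suc (map suc β)) (trans (length-map suc β) length-β))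
  ; length-β = cong (3 +_) (trans (length-map suc α) length-α)
  ; between-α = (s≤s (s≤s z≤n) , n≤1+n _) ∷ (≤-refl , s≤s (s≤s z≤n)) ∷ (s≤s (s≤s z≤n) , ≤-refl)
              ∷ Between-weaken (n≤1+n 2) (m≤n+m (2 + k) 2) between-β⁺
  ; between-β = (s≤s z≤n , s≤s (s≤s z≤n)) ∷ (s≤s z≤n , ≤-refl) ∷ (≤-refl , s≤s z≤n)
              ∷ Between-weaken (m≤n+m 1 2) (n≤1+n _) between-α⁺
  ; unique-α = ((λ ()) ∷ 1+n≢n ∘ sym ∷ above-∉ ≤-refl between-β⁺)
             ∷ ((λ ()) ∷ below-∉ ≤-refl between-β⁺)
             ∷ above-∉ (n≤1+n _) between-β⁺
             ∷ Uniq.map⁺ suc-injective (Uniq.map⁺ suc-injective unique-β)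
  ; unique-β = ((λ ()) ∷ (λ ()) ∷ below-∉ ≤-refl between-α⁺)
             ∷ ((λ ()) ∷ above-∉ ≤-refl between-α⁺)
             ∷ below-∉ (s≤s (s≤s z≤n)) between-α⁺
             ∷ Uniq.map⁺ suc-injective unique-α
  ; steps-α = λ _ 1≤d d≤ → steps-α⁺ 1≤d (split d≤)
  ; steps-β = λ _ 1≤d d≤ → steps-β⁺ 1≤d (split d≤)
  }
  where
  open Zigzags z
  α⁺ β⁺ : List ℕ
  α⁺ = map suc α
  β⁺ = map suc (map suc β)
  between-α⁺ : Between 3 (2 + k) α⁺
  between-α⁺ = Between-map-suc between-α
  between-β⁺ : Between 3 (2 + k) β⁺
  between-β⁺ = Between-map-suc (Between-map-suc between-β)

  Split : ℕ → Set
  Split d = d ≡ 3 + k ⊎ d ≡ 2 + k ⊎ d ≡ 1 + k ⊎ d ≤ k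
  split : ∀ {d} → d ≤ 3 + k → Split d
  split d≤ with m≤n⇒m<n∨m≡n d≤
  ... | inj₂ e = inj₁ e
  ... | inj₁ (s≤s d≤′) with m≤n⇒m<n∨m≡n d≤′
  ... | inj₂ e = inj₂ (inj₁ e)
  ... | inj₁ (s≤s d≤″) with m≤n⇒m<n∨m≡n d≤″
  ... | inj₂ e = inj₂ (inj₂ (inj₁ e))
  ... | inj₁ (s≤s d≤k) = inj₂ (inj₂ (inj₂ d≤k))

  steps-α⁺ : ∀ {d} → 1 ≤ d → Split d → HasStep d (0 ∷ 3 + k ∷ 2 ∷ 4 + k ∷ β⁺)
  steps-α⁺ 1≤d (inj₁ refl)               = here refl
  steps-α⁺ 1≤d (inj₂ (inj₁ refl))        = there (there (here refl))
  steps-α⁺ 1≤d (inj₂ (inj₂ (inj₁ refl))) = there (here refl)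
  steps-α⁺ 1≤d (inj₂ (inj₂ (inj₂ d≤k))) =
    there (there (there (HasStep-map-suc (HasStep-map-suc (steps-β _ 1≤d d≤k)))))

  steps-β⁺ : ∀ {d} → 1 ≤ d → Split d → HasStep d (5 + k ∷ 2 ∷ 3 + k ∷ 1 ∷ α⁺)
  steps-β⁺ 1≤d (inj₁ refl)               = here refl
  steps-β⁺ 1≤d (inj₂ (inj₁ refl))        = there (there (here refl))
  steps-β⁺ 1≤d (inj₂ (inj₂ (inj₁ refl))) = there (here refl)
  steps-β⁺ 1≤d (inj₂ (inj₂ (inj₂ d≤k))) =
    there (there (there (HasStep-map-suc (steps-α _ 1≤d d≤k))))

zigzags-0 : Zigzags 0
zigzags-0 = record
  { α = [] ; β = [] ; length-α = refl ; length-β = refl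
  ; between-α = [] ; between-β = [] ; unique-α = [] ; unique-β = []
  ; steps-α = λ _ 1≤d d≤0 → ⊥-elim (<⇒≱ 1≤d d≤0)
  ; steps-β = λ _ 1≤d d≤0 → ⊥-elim (<⇒≱ 1≤d d≤0)
  }

between? : ∀ lo hi xs → Dec (Between lo hi xs)
between? lo hi = All.all? λ x → lo ≤? x ×-dec x ≤? hi

zigzags-2 : Zigzags 2
zigzags-2 = record
  { α = 2 ∷ 3 ∷ [] ; β = 2 ∷ 1 ∷ [] ; length-α = refl ; length-β = refl
  ; between-α = toWitness {a? = between? 2 3 _} _ ; between-β = toWitness {a? = between? 1 2 _} _
  ; unique-α = toWitness {a? = unique? _} _ ; unique-β = toWitness {a? = unique? _} _
  ; steps-α = λ where
      1 _ _ → there (here refl)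
      2 _ _ → here refl
      (suc (suc (suc _))) _ (s≤s (s≤s ()))
  ; steps-β = λ where
      1 _ _ → there (here refl)
      2 _ _ → here refl
      (suc (suc (suc _))) _ (s≤s (s≤s ()))
  }

zigzags-4 : Zigzags 4
zigzags-4 = record
  { α = 4 ∷ 3 ∷ 5 ∷ 2 ∷ [] ; β = 2 ∷ 3 ∷ 1 ∷ 4 ∷ [] ; length-α = refl ; length-β = refl
  ; between-α = toWitness {a? = between? 2 5 _} _ ; between-β = toWitness {a? = between? 1 4 _} _
  ; unique-α = toWitness {a? = unique? _} _ ; unique-β = toWitness {a? = unique? _} _
  ; steps-α = λ where
      1 _ _ → there (here refl)
      2 _ _ → there (there (here refl))
      3 _ _ → there (there (there (here refl)))
      4 _ _ → here refl
      (suc (suc (suc (suc (suc _))))) _ (s≤s (s≤s (s≤s (s≤s ()))))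
  ; steps-β = λ where
      1 _ _ → there (here refl)
      2 _ _ → there (there (here refl))
      3 _ _ → there (there (there (here refl)))
      4 _ _ → here refl
      (suc (suc (suc (suc (suc _))))) _ (s≤s (s≤s (s≤s (s≤s ()))))
  }

-- The recursion preserves `k` modulo 3. The base cases 0, 2 and 4 cover all residues, with 4
-- standing in for the missing case 1.
zigzags : ∀ k → k ≢ 1 → Zigzags k
zigzags 0 _   = zigzags-0
zigzags 1 1≢1 = ⊥-elim (1≢1 refl)
zigzags 2 _   = zigzags-2
zigzags 4 _   = zigzags-4
zigzags 3 _   = zigzags-3+ zigzags-0
-- The argument is at least 5 here, so the recursive call has `k` at least 2 and avoids 1.
zigzags (suc (suc (suc k@(suc (suc _))))) _ = zigzags-3+ (zigzags k λ ())

-- The arm of length c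

-- `step-m` is separate from `self` because the difference `m` would belong to the label 1 + m,
-- which does not occur. By `extreme`, a label above `c` can only be m - 1 or m.
record CentralArm (c m : ℕ) : Set where
  field
    {labels} : List ℕ
    length≡c : length labels ≡ c
    unique   : Unique (1 ∷ labels)
    extreme  : All (λ x → x ≤ c ⊎ m ≤ suc x × x ≤ m) labels
    self     : SelfStepping labels
    step-m   : HasStep m (1 ∷ labels)

-- The labels are `m ∷ 0 ∷ α`. The edge at the hub gives m - 1, the next edge gives m, and the path
-- `0 ∷ α` gives 1, ..., k, the differences that the labels of `α` call for.
centralArm-zigzag : ∀ {k m} → Zigzags k → suc (suc k) < m → CentralArm (2 + k) m
centralArm-zigzag {k} {m} z c<m = record
  { length≡c = cong (2 +_) length-α
  ; unique   = (<⇒≢ (≤-trans (s≤s (s≤s z≤n)) c<m) ∷ (λ ()) ∷ below-∉ ≤-refl between-α)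
             ∷ (>⇒≢ (≤-trans (s≤s z≤n) c<m) ∷ above-∉ (<⇒≤ c<m) between-α)
             ∷ below-∉ (s≤s z≤n) between-α
             ∷ unique-α
  ; extreme  = inj₂ (n≤1+n m , ≤-refl) ∷ inj₁ z≤n
             ∷ All.map (λ (_ , x≤) → inj₁ (≤-trans x≤ (n≤1+n _))) between-α
  ; self     = self
  ; step-m   = there (here (∣-∣-identityʳ m))
  }
  where
  open Zigzags z
  self : SelfStepping (m ∷ 0 ∷ α)
  self d 1≤d (here refl)       = here refl
  -- The entry 0 is not of the form `suc d`, so only entries of `α` remain, and these satisfy
  -- `suc d ≤ suc k`.
  self d 1≤d (there (there p)) with s≤s d≤k ← proj₂ (All.lookup between-α p) =
    there (there (steps-α _ 1≤d d≤k))

-- Along 1, n, 0, n + 1 the differences are n - 1, n and n + 1. The first two belong to the labels n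
-- and n + 1, and the last is the maximal difference.
centralArm-3 : ∀ {n} → 3 ≤ n → CentralArm 3 (suc n)
centralArm-3 {n} 3≤n = record
  { length≡c = refl
  ; unique   = (<⇒≢ (≤-trans (s≤s (s≤s z≤n)) 3≤n) ∷ (λ ()) ∷ <⇒≢ (s≤s (≤-trans (s≤s z≤n) 3≤n)) ∷ [])
             ∷ (>⇒≢ (≤-trans (s≤s z≤n) 3≤n) ∷ 1+n≢n ∘ sym ∷ [])
             ∷ ((λ ()) ∷ [])
             ∷ [] ∷ []
  ; extreme  = inj₂ (≤-refl , n≤1+n n) ∷ inj₁ z≤n ∷ inj₂ (n≤1+n _ , ≤-refl) ∷ []
  ; self     = self
  ; step-m   = there (there (here refl))
  }
  where
  self : SelfStepping (n ∷ 0 ∷ suc n ∷ [])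
  self d _ (here refl)                 = here refl
  self d _ (there (there (here refl))) = there (here (∣-∣-identityʳ n))

centralArm : ∀ {c m} → 2 ≤ c → c < m → CentralArm c m
centralArm {1} (s≤s ()) _
centralArm {2} _ c<m = centralArm-zigzag (zigzags 0 λ ()) c<m
centralArm {3} _ (s≤s 3≤n) = centralArm-3 3≤n
centralArm {suc (suc k@(suc (suc _)))} _ c<m = centralArm-zigzag (zigzags k λ ()) c<m

-- Assembling the labeling

-- With `ℓs` a variable, matching on `refl` carries the result over to prescribed arm lengths that
-- agree with `map length xss` only propositionally.
gracefulFromArms : ∀ {h ℓs xss} → map length xss ≡ ℓs → h ∷ concat xss ↭ upTo (suc (sum ℓs)) →
  (∀ {d} → 1 ≤ d → d < suc (sum ℓs) → Any (λ xs → HasStep d (h ∷ xs)) xss) →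
  GracefulWithHubAt h ℓs
gracefulFromArms refl = gracefulSpider

length-concat : ∀ {A : Set} (xss : List (List A)) → length (concat xss) ≡ sum (map length xss)
length-concat []         = refl
length-concat (xs ∷ xss) = trans (length-++ xs) (cong (length xs +_) (length-concat xss))

map-length-[-] : ∀ {A : Set} (xs : List A) → map length (map [_] xs) ≡ replicate (length xs) 1
map-length-[-] []       = refl
map-length-[-] (_ ∷ xs) = cong (1 ∷_) (map-length-[-] xs)

sum-replicate-1 : ∀ n → sum (replicate n 1) ≡ n
sum-replicate-1 zero    = refl
sum-replicate-1 (suc n) = cong suc (sum-replicate-1 n)

module _ {c : ℕ} {ℓs : List ℕ} (t : ℕ) (2≤c : 2 ≤ c) (S : SmallArms c ℓs) where
  private
    module S = SmallArms S
    all-ℓs : List ℕ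
    all-ℓs = c ∷ ℓs ++ replicate t 1
    m : ℕ
    m = sum all-ℓs

    m≡ : m ≡ c + (sum ℓs + t)
    m≡ = cong (c +_) (trans (sum-++ ℓs (replicate t 1)) (cong (sum ℓs +_) (sum-replicate-1 t)))

    t≤m : t ≤ m
    t≤m = subst (t ≤_) (sym m≡) (≤-trans (m≤n+m t (sum ℓs)) (m≤n+m _ c))

  -- The threshold on `t` forces m - 1 above `hi`, so the large labels m - 1 and m of the central
  -- arm do not meet the small arms.
  gracefulFromSmallArms : 2 + S.hi ≤ t → GracefulWithHubAt 1 all-ℓs
  gracefulFromSmallArms 2+hi≤t = gracefulFromArms lengths perm′ steps
    where
    2+hi≤m : 2 + S.hi ≤ m
    2+hi≤m = ≤-trans 2+hi≤t t≤m

    hi≤m : S.hi ≤ m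
    hi≤m = ≤-trans (m≤n+m _ 2) 2+hi≤m

    c<m : c < m
    c<m = ≤-trans (s≤s S.lo≤hi) (≤-trans (n≤1+n _) 2+hi≤m)

    module C = CentralArm (centralArm 2≤c c<m)

    used : List ℕ
    used = 1 ∷ C.labels ++ concat S.arms

    central∩small : ∀ {x} → x ∈ 1 ∷ C.labels → x ∉ concat S.arms
    central∩small x∈C x∈S with All.lookup S.between x∈S
    central∩small (here refl) x∈S | c<x , _ = <⇒≱ c<x (<⇒≤ 2≤c)
    central∩small (there x∈C) x∈S | c<x , x≤hi with All.lookup C.extreme x∈C
    ... | inj₁ x≤c         = <⇒≱ c<x x≤c
    ... | inj₂ (m≤1+x , _) = <⇒≱ 2+hi≤m (≤-trans m≤1+x (s≤s x≤hi))

    used-unique : Unique used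
    used-unique = Uniq.++⁺ C.unique S.unique λ (x∈C , x∈S) → central∩small x∈C x∈S

    used-≤m : All (_≤ m) used
    used-≤m = <⇒≤ (≤-trans 2≤c (<⇒≤ c<m)) ∷ Allₚ.++⁺ (All.map extreme-≤ C.extreme)
                                                  (All.map (λ (_ , x≤hi) → ≤-trans x≤hi hi≤m) S.between)
      where
      extreme-≤ : ∀ {x} → x ≤ c ⊎ m ≤ suc x × x ≤ m → x ≤ m
      extreme-≤ (inj₁ x≤c)       = ≤-trans x≤c (<⇒≤ c<m)
      extreme-≤ (inj₂ (_ , x≤m)) = x≤m

    complement-used : ∃[ ys ] used ++ ys ↭ upTo (suc m)
    complement-used = complement used-unique (All.map (∈-upTo⁺ ∘ s≤s) used-≤m)

    leaves : List ℕ
    leaves = proj₁ complement-used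

    perm : used ++ leaves ↭ upTo (suc m)
    perm = proj₂ complement-used

    length-used : length used ≡ suc (c + sum ℓs)
    length-used = cong suc (trans (length-++ C.labels)
      (cong₂ _+_ C.length≡c (trans (length-concat S.arms) (cong sum S.lengths))))

    -- Counting: the `suc m` labels split into the `suc (c + sum ℓs)` used ones and those of the
    -- leaves.
    length-leaves : length leaves ≡ t
    length-leaves = +-cancelˡ-≡ (suc (c + sum ℓs)) _ _ (begin
      suc (c + sum ℓs) + length leaves ≡⟨ cong (_+ length leaves) length-used ⟨
      length used + length leaves      ≡⟨ length-++ used ⟨
      length (used ++ leaves)          ≡⟨ ↭-length perm ⟩
      length (upTo (suc m))            ≡⟨ length-upTo (suc m) ⟩
      suc m                            ≡⟨ cong suc m≡ ⟩
      suc (c + (sum ℓs + t))           ≡⟨ cong suc (+-assoc c (sum ℓs) t) ⟨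
      suc (c + sum ℓs) + t             ∎)
      where open ≡-Reasoning

    xss : List (List ℕ)
    xss = C.labels ∷ S.arms ++ map [_] leaves

    lengths : map length xss ≡ all-ℓs
    lengths = cong₂ _∷_ C.length≡c (trans (map-++ length S.arms _)
      (cong₂ _++_ S.lengths (trans (map-length-[-] leaves) (cong (λ n → replicate n 1) length-leaves))))

    concat-xss : used ++ leaves ≡ 1 ∷ concat xss
    concat-xss = cong (1 ∷_) (begin
      (C.labels ++ concat S.arms) ++ leaves                ≡⟨ ++-assoc C.labels _ _ ⟩
      C.labels ++ concat S.arms ++ leaves                  ≡⟨ cong (λ ys → C.labels ++ concat S.arms ++ ys) (concat-map-[ leaves ]) ⟨
      C.labels ++ concat S.arms ++ concat (map [_] leaves) ≡⟨ cong (C.labels ++_) (concat-++ S.arms _) ⟩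
      concat xss                                        ∎)
      where open ≡-Reasoning

    perm′ : 1 ∷ concat xss ↭ upTo (suc m)
    perm′ = subst (_↭ upTo (suc m)) concat-xss perm

    xss-self : All SelfStepping xss
    xss-self = C.self ∷ Allₚ.++⁺ S.self (Allₚ.map⁺ (All.universal SelfStepping-[_] leaves))

    steps : ∀ {d} → 1 ≤ d → d < suc m → Any (λ xs → HasStep d (1 ∷ xs)) xss
    steps {d} 1≤d (s≤s d≤m) with m≤n⇒m<n∨m≡n d≤m
    ... | inj₂ refl = here C.step-m
    -- For d < m the value 1 + d is itself a label. As it differs from the hub label 1, it lies on
    -- some arm, and that arm realises d.
    ... | inj₁ d<m with ∈-resp-↭ (↭-sym perm′) (∈-upTo⁺ (s≤s d<m))
    ... | here 1+d≡1 = ⊥-elim (<⇒≢ (s≤s 1≤d) (sym 1+d≡1))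
    ... | there 1+d∈ =
      let xs , xs∈xss , 1+d∈xs = find (∈-concat⁻ xss 1+d∈)
      in  lose xs∈xss (All.lookup xss-self xs∈xss d 1≤d 1+d∈xs)

corollary3p6 : (c : ℕ) → 2 ≤ c → (L : List ℕ) → All (2 ≤_) L →
    ∃[ t₀ ] ((t : ℕ) → t ≥ t₀ →
    let ℓs = c ∷ L ++ replicate t 1 in
    Σ[ f ∈ (Vertex ℓs ⤖ Fin (suc (sum ℓs))) ]
    (IsGraceful (Spider ℓs) f × toℕ (Bijection.to f hub) ≡ 1))
corollary3p6 c 2≤c L _ =
  -- `S` is built from `c` and `L` before `t` is given, so the threshold does not depend on `t`.
  -- Starting at scale `c` keeps its labels above the small labels of the central arm.
  2 + SmallArms.hi S , λ t → gracefulFromSmallArms t 2≤c S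
  where
  S : SmallArms c L
  S = smallArms (<⇒≤ 2≤c) L
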